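{- Let $G$ be a finite simple undirected $P_6$-free graph that has an efficient dominating set $D$, and let $C$ be an odd antihole in $G^2$ with vertex set $R(C)$. Then $|D\cap R(C)|=0$.
   Context: All graphs are finite, undirected and simple. A vertex dominates itself and its neighbors. A set $D\subseteq V$ is an efficient dominating set of $G=(V,E)$ if every vertex of $G$ is dominated by exactly one vertex of $D$. The square $G^2=(V,E^2)$ has $uv\in E^2$ iff $d_G(u,v)\in\{1,2\}$. $P_6$-free means having no induced chordless path on 6 vertices. An odd antihole in $G^2$ is an induced subgraph of $G^2$ isomorphic to the complement $\overline{C_{2k+1}}$ of a chordless cycle with $2k+1$ vertices, $k\ge 2$; its vertices are called its real vertices, and $R(C)$ denotes the set of real vertices of $C$. -}

module Defs where

open import Data.Fin.Base using (Fin; toℕ)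
open import Data.Fin.Properties using (any?) renaming (_≟_ to _≟ᶠ_)
open import Data.Fin.Subset using (Subset; _∈_)
open import Data.Nat.Base using (ℕ; zero; suc; _+_; _*_; _≤_; _<_; z≤n; s≤s)
open import Data.Nat.Properties using (allUpTo?) renaming (_≟_ to _≟ⁿ_)
open import Data.Product using (∃; ∃!; _×_; _,_)
open import Data.Sum.Base using (_⊎_; inj₁; inj₂; swap; [_,_])
open import Data.Vec.Base using (tabulate)
open import Function.Base using (_∘_)
open import Function.Bundles using (_⇔_)
open import Function.Definitions using (Injective)
open import Level using (0ℓ)
open import Relation.Binary.Core using (Rel)
open import Relation.Binary.Definitions using (Symmetric; Irreflexive; Decidable)
open import Relation.Binary.PropositionalEquality using (_≡_; _≢_; refl; sym; ≢-sym)
open import Relation.Nullary using (¬_; does)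
open import Relation.Nullary.Decidable using (¬?; _×-dec_; _⊎-dec_)

record Graph (n : ℕ) : Set₁ where
  field
    Adj        : Rel (Fin n) 0ℓ
    adj-sym    : Symmetric Adj
    adj-irrefl : Irreflexive _≡_ Adj
    adj?       : Decidable Adj

open Graph public

private
  variable
    m n : ℕ

Walk : Graph n → ℕ → Rel (Fin n) 0ℓ
Walk G zero    u v = u ≡ v
Walk G (suc k) u v = ∃ λ w → Adj G u w × Walk G k w v

walk? : (G : Graph n) (k : ℕ) → Decidable (Walk G k)
walk? G zero    u v = u ≟ᶠ v
walk? G (suc k) u v = any? λ w → adj? G u w ×-dec walk? G k w v

walk-snoc : (G : Graph n) (k : ℕ) {u v w : Fin n} →
            Walk G k u v → Adj G v w → Walk G (suc k) u w
walk-snoc G zero    refl        b = _ , b , refl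
walk-snoc G (suc k) (_ , a , p) b = _ , a , walk-snoc G k p b

walk-reverse : (G : Graph n) (k : ℕ) → Symmetric (Walk G k)
walk-reverse G zero    p           = sym p
walk-reverse G (suc k) (_ , a , p) = walk-snoc G k (walk-reverse G k p) (adj-sym G a)

-- `Distance G d u v` says d_G(u,v) = d; it holds for no d when u and v
-- lie in different components.
Distance : Graph n → ℕ → Rel (Fin n) 0ℓ
Distance G d u v = Walk G d u v × (∀ {k} → k < d → ¬ Walk G k u v)

distance? : (G : Graph n) (d : ℕ) → Decidable (Distance G d)
distance? G d u v = walk? G d u v ×-dec allUpTo? (λ k → ¬? (walk? G k u v)) d

distance-sym : (G : Graph n) (d : ℕ) → Symmetric (Distance G d)
distance-sym G d (p , min) =
  walk-reverse G d p , λ k<d q → min k<d (walk-reverse G _ q)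

distance-irrefl : (G : Graph n) (d : ℕ) → Irreflexive _≡_ (Distance G (suc d))
distance-irrefl G d u≡v (_ , min) = min (s≤s z≤n) u≡v

_² : Graph n → Graph n
G ² = record
  { Adj        = λ u v → Distance G 1 u v ⊎ Distance G 2 u v
  ; adj-sym    = λ { (inj₁ p) → inj₁ (distance-sym G 1 p)
                   ; (inj₂ p) → inj₂ (distance-sym G 2 p) }
  ; adj-irrefl = λ u≡v → [ distance-irrefl G 0 u≡v , distance-irrefl G 1 u≡v ]
  ; adj?       = λ u v → distance? G 1 u v ⊎-dec distance? G 2 u v
  }

complement : Graph n → Graph n
complement G = record
  { Adj        = λ u v → u ≢ v × ¬ Adj G u v
  ; adj-sym    = λ (u≢v , ¬a) → ≢-sym u≢v , ¬a ∘ adj-sym G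
  ; adj-irrefl = λ u≡v (u≢v , _) → u≢v u≡v
  ; adj?       = λ u v → ¬? (u ≟ᶠ v) ×-dec ¬? (adj? G u v)
  }

-- The simple graph underlying a relation: orientations and loops are dropped.
fromRelation : (R : Rel (Fin n) 0ℓ) → Decidable R → Graph n
fromRelation R R? = record
  { Adj        = λ i j → i ≢ j × (R i j ⊎ R j i)
  ; adj-sym    = λ (i≢j , r) → ≢-sym i≢j , swap r
  ; adj-irrefl = λ i≡j (i≢j , _) → i≢j i≡j
  ; adj?       = λ i j → ¬? (i ≟ᶠ j) ×-dec (R? i j ⊎-dec R? j i)
  }

-- The chordless path on n vertices.
path : (n : ℕ) → Graph n
path n = fromRelation (λ i j → toℕ j ≡ suc (toℕ i))
                      (λ i j → toℕ j ≟ⁿ suc (toℕ i))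

-- The chordless cycle on n vertices; only meaningful for n ≥ 3.
cycle : (n : ℕ) → Graph n
cycle n = fromRelation
  (λ i j → toℕ j ≡ suc (toℕ i) ⊎ (suc (toℕ i) ≡ n × toℕ j ≡ 0))
  (λ i j → (toℕ j ≟ⁿ suc (toℕ i)) ⊎-dec ((suc (toℕ i) ≟ⁿ n) ×-dec (toℕ j ≟ⁿ 0)))

-- An induced subgraph of G isomorphic to H, given by an isomorphism from H
-- onto the subgraph of G induced by the image of `vertex`.
record InducedCopy (H : Graph m) (G : Graph n) : Set where
  field
    vertex    : Fin m → Fin n
    injective : Injective _≡_ _≡_ vertex
    adjacency : ∀ i j → Adj H i j ⇔ Adj G (vertex i) (vertex j)

  vertexSet : Subset n
  vertexSet = tabulate λ v → does (any? λ i → vertex i ≟ᶠ v)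

_IsFreeOf_ : Graph n → Graph m → Set
G IsFreeOf H = ¬ InducedCopy H G

record OddAntihole (G : Graph n) : Set where
  field
    k    : ℕ
    2≤k  : 2 ≤ k
    copy : InducedCopy (complement (cycle (2 * k + 1))) G

  realVertices : Subset n
  realVertices = InducedCopy.vertexSet copy

open OddAntihole public using (realVertices)

Dominates : Graph n → Rel (Fin n) 0ℓ
Dominates G d v = d ≡ v ⊎ Adj G d v

IsEfficientDominatingSet : Graph n → Subset n → Set
IsEfficientDominatingSet G D = ∀ v → ∃! _≡_ λ d → d ∈ D × Dominates G d v

-- Going round C from a vertex d ∈ D gives d, v₁, …, v₂ₖ with consecutive vertices
-- (cyclically) at distance ≥ 3 and all other pairs at distance ≤ 2.  So each of
-- v₂, …, v₂ₖ₋₁ is a neighbour or a second neighbour of d.  Consecutive ones cannot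
-- both be neighbours, and if both were second neighbours their dominators would
-- complete a chordless P₆.  Hence the two types alternate; as there are 2k − 2 of
-- these vertices, v₂ and v₂ₖ₋₁ have different types, and this again forces a P₆.
module Submission where

open import Defs
open import Data.Bool.Base using (true)
open import Data.Empty using (⊥; ⊥-elim)
open import Data.Fin.Base as Fin using (Fin; suc; toℕ)
open import Data.Fin.Patterns using (0F; 1F; 2F; 3F; 4F; 5F)
open import Data.Fin.Properties using (all?; any?; <-cmp; toℕ-injective; toℕ<n; toℕ-fromℕ<)
  renaming (_≟_ to _≟ᶠ_)
open import Data.Fin.Subset using (Subset; _∩_; ∣_∣; _∈_; Empty)
open import Data.Fin.Subset.Properties using (Empty-unique; ∣⊥∣≡0; x∈p∩q⁻)
open import Data.Nat.Base using (ℕ; zero; suc; pred; _+_; _*_; _≤_; _<_; z≤n; s≤s; NonZero)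
open import Data.Nat.DivMod using (_%_; _mod_; %-distribˡ-+; m%n<n; m<n⇒m%n≡m; m%n%n≡m%n; [m+n]%n≡m%n; n%n≡0)
open import Data.Nat.Properties using
  ( ≤-refl; <⇒≤; <⇒≢; <-trans; n<1+n; n≤1+n; m≤m+n; m≤n⇒m≤1+n; m≤n⇒m<n∨m≡n; *-monoˡ-≤
  ; +-suc; +-comm; +-assoc; +-identityʳ; *-comm; suc-pred; 0≢1+n)
open import Data.Product using (∃; _×_; _,_; proj₁; proj₂)
open import Data.Sum.Base using (_⊎_; inj₁; inj₂; [_,_])
open import Data.Vec.Base using ([]; _∷_; lookup)
open import Data.Vec.Properties using (lookup∘tabulate; []=⇒lookup)
open import Function.Base using (_∘_; const; id)
open import Function.Bundles using (_⇔_; mk⇔; Equivalence)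
open import Relation.Binary.Definitions using (tri<; tri≈; tri>)
open import Relation.Binary.PropositionalEquality
  using (_≡_; _≢_; refl; sym; trans; cong; subst; subst₂; module ≡-Reasoning)
open import Relation.Nullary using (¬_; Dec; does; yes; no; contradiction)
open import Relation.Nullary.Decidable using (_×-dec_; _→-dec_; from-yes; from-no; decidable-stable)

open Equivalence using (to; from)

-- Induced paths on six vertices.

path₆-twin-free : ∀ i j →
  (∀ k → (Adj (path 6) i k → Adj (path 6) j k) × (Adj (path 6) j k → Adj (path 6) i k)) → i ≡ j
path₆-twin-free = from-yes (all? λ i → all? λ j →
  (all? λ k → (adj? (path 6) i k →-dec adj? (path 6) j k) ×-dec
              (adj? (path 6) j k →-dec adj? (path 6) i k)) →-dec (i ≟ᶠ j))

-- The path has no two vertices with the same neighbours, so distinctness of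
-- a, …, f need not be assumed.
chordless-path₆ : ∀ {n} (G : Graph n) → G IsFreeOf path 6 →
  let infix 4 _~_ _≁_
      _~_ = Adj G
      _≁_ = λ x y → ¬ Adj G x y in
  ∀ {a b c d e f} →
  a ~ b → b ~ c → c ~ d → d ~ e → e ~ f →
  a ≁ c → a ≁ d → a ≁ e → a ≁ f → b ≁ d → b ≁ e → b ≁ f → c ≁ e → c ≁ f → d ≁ f → ⊥
chordless-path₆ G P₆-free {a} {b} {c} {d} {e} {f}
  ab bc cd de ef ac ad ae af bd be bf ce cf df =
  P₆-free record { vertex = v ; injective = inj ; adjacency = adjacency }
  where
  v : Fin 6 → Fin _
  v = lookup (a ∷ b ∷ c ∷ d ∷ e ∷ f ∷ [])

  edge : ∀ {A B : Set} → A → B → A ⇔ B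
  edge x y = mk⇔ (const y) (const x)

  nonedge : ∀ {A B : Set} → ¬ A → ¬ B → A ⇔ B
  nonedge ¬x ¬y = mk⇔ (⊥-elim ∘ ¬x) (⊥-elim ∘ ¬y)

  P? = adj? (path 6)

  upper : ∀ i j → i Fin.< j → Adj (path 6) i j ⇔ Adj G (v i) (v j)
  upper 0F 1F _ = edge (from-yes (P? 0F 1F)) ab
  upper 0F 2F _ = nonedge (from-no (P? 0F 2F)) ac
  upper 0F 3F _ = nonedge (from-no (P? 0F 3F)) ad
  upper 0F 4F _ = nonedge (from-no (P? 0F 4F)) ae
  upper 0F 5F _ = nonedge (from-no (P? 0F 5F)) af
  upper 1F 2F _ = edge (from-yes (P? 1F 2F)) bc
  upper 1F 3F _ = nonedge (from-no (P? 1F 3F)) bd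
  upper 1F 4F _ = nonedge (from-no (P? 1F 4F)) be
  upper 1F 5F _ = nonedge (from-no (P? 1F 5F)) bf
  upper 2F 3F _ = edge (from-yes (P? 2F 3F)) cd
  upper 2F 4F _ = nonedge (from-no (P? 2F 4F)) ce
  upper 2F 5F _ = nonedge (from-no (P? 2F 5F)) cf
  upper 3F 4F _ = edge (from-yes (P? 3F 4F)) de
  upper 3F 5F _ = nonedge (from-no (P? 3F 5F)) df
  upper 4F 5F _ = edge (from-yes (P? 4F 5F)) ef
  upper (suc _) 1F (s≤s ())
  upper (suc (suc _)) 2F (s≤s (s≤s ()))
  upper (suc (suc (suc _))) 3F (s≤s (s≤s (s≤s ())))
  upper (suc (suc (suc (suc _)))) 4F (s≤s (s≤s (s≤s (s≤s ()))))
  upper (suc (suc (suc (suc (suc _))))) 5F (s≤s (s≤s (s≤s (s≤s (s≤s ())))))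

  adjacency : ∀ i j → Adj (path 6) i j ⇔ Adj G (v i) (v j)
  adjacency i j with <-cmp i j
  ... | tri< i<j _ _ = upper i j i<j
  ... | tri≈ _ i≡j _ = nonedge (adj-irrefl (path 6) i≡j) (adj-irrefl G (cong v i≡j))
  ... | tri> _ _ j<i = mk⇔ (adj-sym G ∘ to (upper j i j<i) ∘ adj-sym (path 6) {i} {j})
                           (adj-sym (path 6) {j} {i} ∘ from (upper j i j<i) ∘ adj-sym G)

  inj : ∀ {i j} → v i ≡ v j → i ≡ j
  inj {i} {j} vi≡vj = path₆-twin-free i j λ k →
    (from (adjacency j k) ∘ subst (λ x → Adj G x (v k)) vi≡vj ∘ to (adjacency i k)) ,
    (from (adjacency i k) ∘ subst (λ x → Adj G x (v k)) (sym vi≡vj) ∘ to (adjacency j k))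

-- Distance in `G` and adjacency in its square.

module Square {n} (G : Graph n) where

  private
    variable
      x y z : Fin n

  infix 4 _~_ _≁_

  -- `Far` amounts to distance at least 3, different components included.
  _~_ _≁_ Near Far : Fin n → Fin n → Set
  _~_    = Adj G
  x ≁ y  = ¬ x ~ y
  Near   = Adj (G ²)
  Far    = Adj (complement (G ²))

  ~-sym : x ~ y → y ~ x
  ~-sym = adj-sym G

  ≁-sym : x ≁ y → y ≁ x
  ≁-sym = _∘ ~-sym

  -- Nearly every new edge below is found this way: its absence would leave an induced six-vertex
  -- path.
  ~-stable : ¬ x ≁ y → x ~ y
  ~-stable {x} {y} = decidable-stable (adj? G x y)

  near-cases : Near x y → x ~ y ⊎ ∃ λ z → x ~ z × z ~ y
  near-cases (inj₁ ((_ , x~y , refl) , _))               = inj₁ x~y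
  near-cases (inj₂ ((z , x~z , _ , z~y , refl) , _)) = inj₂ (z , x~z , z~y)

  near-common : x ≢ y → x ~ z → z ~ y → Near x y
  near-common {x} {y} x≢y x~z z~y with adj? G x y
  ... | yes x~y = inj₁ ((y , x~y , refl) , λ { (s≤s z≤n) x≡y → x≢y x≡y })
  ... | no  x≁y = inj₂ ((_ , x~z , y , z~y , refl) , λ
    { {zero}        _               x≡y            → x≢y x≡y
    ; {suc zero}    _               (_ , a , refl) → x≁y a
    ; {suc (suc _)} (s≤s (s≤s ())) })

  far-sym : Far x y → Far y x
  far-sym = adj-sym (complement (G ²))

  far⇒≁ : Far x y → x ≁ y
  far⇒≁ (x≢y , ¬near) x~y =
    ¬near (inj₁ ((_ , x~y , refl) , λ { (s≤s z≤n) x≡y → x≢y x≡y }))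

  -- A common neighbour would make the distance at most 2. Many non-edges of the paths below come
  -- from here.
  far⇒no-common : Far x y → x ~ z → z ≁ y
  far⇒no-common (x≢y , ¬near) x~z z~y = ¬near (near-common x≢y x~z z~y)

-- Dominators of vertices that `d` does not dominate.

module EfficientDomination
  {n} (G : Graph n) (P₆-free : G IsFreeOf path 6)
  (D : Subset n) (efficient : IsEfficientDominatingSet G D)
  {d : Fin n} (d∈D : d ∈ D)
  where

  open Square G

  private
    variable
      x y z e f u v w a a′ : Fin n

    P₆ : ∀ {a b c d e f} →
      a ~ b → b ~ c → c ~ d → d ~ e → e ~ f →
      a ≁ c → a ≁ d → a ≁ e → a ≁ f → b ≁ d → b ≁ e → b ≁ f → c ≁ e → c ≁ f → d ≁ f → ⊥
    P₆ = chordless-path₆ G P₆-free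

  dominator : ∀ x → ∃ λ e → e ∈ D × Dominates G e x
  dominator x = let e , p , _ = efficient x in e , p

  dominator-unique : e ∈ D → f ∈ D → Dominates G e x → Dominates G f x → e ≡ f
  dominator-unique {x = x} e∈D f∈D p q =
    let _ , _ , unique = efficient x in trans (sym (unique (e∈D , p))) (unique (f∈D , q))

  D-independent : e ∈ D → f ∈ D → e ≁ f
  D-independent e∈D f∈D e~f =
    adj-irrefl G (dominator-unique e∈D f∈D (inj₂ e~f) (inj₁ refl)) e~f

  record SecondNeighbour (x : Fin n) : Set where
    constructor via
    field
      d≢x : d ≢ x
      d≁x : d ≁ x
      {b} : Fin n
      d~b : d ~ b
      b~x : b ~ x

  -- The dominator `e` of `x` cannot be `d`; and as `d` is the only dominator of itself and of its
  -- neighbours, `e` is adjacent to none of these.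
  module Undominated (d≢x : d ≢ x) (d≁x : d ≁ x) (e∈D : e ∈ D) (dom : Dominates G e x) where

    d≢e : d ≢ e
    d≢e refl = [ d≢x , d≁x ] dom

    e≁d : e ≁ d
    e≁d = D-independent e∈D d∈D

    e≁nbr : d ~ y → e ≁ y
    e≁nbr d~y e~y = d≢e (dominator-unique d∈D e∈D (inj₂ d~y) (inj₂ e~y))

  outer-dominator : SecondNeighbour x →
    ∃ λ e → e ∈ D × e ~ x × e ≁ d × (∀ {y} → d ~ y → e ≁ y)
  outer-dominator {x} (via d≢x d≁x d~b b~x) with dominator x
  ... | e , e∈D , dom with dom
  -- Here `x` lies in `D`, so `b` would be dominated by both `d` and `x`.
  ...   | inj₁ refl = contradiction (~-sym b~x) (Undominated.e≁nbr d≢x d≁x e∈D dom d~b)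
  ...   | inj₂ e~x  = e , e∈D , e~x , U.e≁d , U.e≁nbr
    where module U = Undominated d≢x d≁x e∈D dom

  -- The forbidden path is `e x b b′ y f`, with `e` and `f` the dominators of `x` and `y`. It needs
  -- the edge `b ~ b′`; without that edge `e x b d b′ y` is chordless.
  second-neighbours-not-far : SecondNeighbour x → SecondNeighbour y → ¬ Far x y
  second-neighbours-not-far
    Nx@(via _ d≁x {b} d~b b~x) Ny@(via _ d≁y {b′} d~b′ b′~y) far
    with outer-dominator Nx | outer-dominator Ny
  ... | e , e∈D , e~x , e≁d , e≁N | f , f∈D , f~y , f≁d , f≁N =
    P₆ e~x (~-sym b~x) b~b′ b′~y (~-sym f~y)
      (e≁N d~b) (e≁N d~b′) e≁y (D-independent e∈D f∈D)
      x≁b′ (far⇒≁ far) x≁f b≁y (≁-sym (f≁N d~b)) (≁-sym (f≁N d~b′))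
    where
    x≁b′ = λ x~b′ → far⇒no-common far x~b′ b′~y
    b≁y  = far⇒no-common far (~-sym b~x)
    e≁y  = far⇒no-common far (~-sym e~x)
    x≁f  = λ x~f → far⇒no-common far x~f f~y
    b~b′ = ~-stable λ b≁b′ →
      P₆ e~x (~-sym b~x) (~-sym d~b) d~b′ b′~y
        (e≁N d~b) e≁d (e≁N d~b′) e≁y (≁-sym d≁x) x≁b′ (far⇒≁ far) b≁b′ b≁y d≁y

  -- The contradiction near the two ends of the alternating sequence.

  -- With C = (d, v₁, …, v₂ₖ): v = v₁, w = v₂ₖ, a = v₂, z = v₂ₖ₋₁ and a′ = v₂ₖ₋₂,
  -- or the mirror image of this; for k = 2 the vertices a and a′ coincide.
  module Ends
    (d~a : d ~ a) (d~a′ : d ~ a′) (Nz : SecondNeighbour z)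
    (d-v : Far d v) (d-w : Far d w) (v-a : Far v a) (a′-z : Far a′ z) (z-w : Far z w)
    (v≈z : Near v z) (v≈w : Near v w) (a≈w : Near a w)
    where

    open SecondNeighbour Nz using (b; d~b) renaming (d≁x to d≁z; b~x to b~z)

    v≁d : v ≁ d
    v≁d = ≁-sym (far⇒≁ d-v)

    w≁d : w ≁ d
    w≁d = ≁-sym (far⇒≁ d-w)

    v≁nbr : d ~ x → v ≁ x
    v≁nbr d~x = ≁-sym (far⇒no-common d-v d~x)

    w≁nbr : d ~ x → w ≁ x
    w≁nbr d~x = ≁-sym (far⇒no-common d-w d~x)

    v-nbr≁d : v ~ x → x ≁ d
    v-nbr≁d v~x x~d = far⇒no-common (far-sym d-v) v~x x~d

    w-nbr≁d : w ~ x → x ≁ d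
    w-nbr≁d w~x x~d = far⇒no-common (far-sym d-w) w~x x~d

    z-nbr≁w : z ~ x → x ≁ w
    z-nbr≁w = far⇒no-common z-w

    z-nbr≁a′ : z ~ x → x ≁ a′
    z-nbr≁a′ = far⇒no-common (far-sym a′-z)

    v-nbr≁a : v ~ x → x ≁ a
    v-nbr≁a = far⇒no-common v-a

    b≁a′ : b ≁ a′
    b≁a′ = z-nbr≁a′ (~-sym b~z)

    z≁d : z ≁ d
    z≁d = ≁-sym d≁z

    z≁a′ : z ≁ a′
    z≁a′ = ≁-sym (far⇒≁ a′-z)

    z≁w : z ≁ w
    z≁w = far⇒≁ z-w

    -- Otherwise `v y z b d a′` is a chordless path.
    link-to-b : v ≁ z → v ~ y → y ~ z → y ~ b
    link-to-b v≁z v~y y~z = ~-stable λ y≁b →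
      P₆ v~y y~z (~-sym b~z) (~-sym d~b) d~a′
        v≁z (v≁nbr d~b) v≁d (v≁nbr d~a′) y≁b (v-nbr≁d v~y) (z-nbr≁a′ (~-sym y~z))
        z≁d z≁a′ b≁a′

    -- Treats `v ~ z` (then `m` is `z`) and distance 2 (then `m` is a common neighbour) alike. In
    -- both cases `v m b d a′` is an induced path, ready to be extended to six vertices.
    record Link : Set where
      field
        {m}  : Fin n
        v~m  : v ~ m
        m~b  : m ~ b
        m≁a′ : m ≁ a′
        m≁w  : m ≁ w

    link : Link
    link with adj? G v z | near-cases v≈z
    ... | yes v~z | _ = record { v~m = v~z ; m~b = ~-sym b~z ; m≁a′ = z≁a′ ; m≁w = z≁w }
    ... | no  v≁z | inj₁ v~z = contradiction v~z v≁z
    ... | no  v≁z | inj₂ (_ , v~c , c~z) = record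
      { v~m  = v~c
      ; m~b  = link-to-b v≁z v~c c~z
      ; m≁a′ = z-nbr≁a′ (~-sym c~z)
      ; m≁w  = z-nbr≁w (~-sym c~z)
      }

    open Link link

    m≁d : m ≁ d
    m≁d = v-nbr≁d v~m

    w≁v : w ≁ v
    w≁v w~v = P₆ w~v v~m m~b (~-sym d~b) d~a′
      (≁-sym m≁w) (w≁nbr d~b) w≁d (w≁nbr d~a′) (v≁nbr d~b) v≁d (v≁nbr d~a′)
      m≁d m≁a′ b≁a′

    -- If e ≁ u then e x u b d a′ is a chordless path.
    push : Far d x → e ∈ D → Dominates G e x → x ~ u → u ~ b → u ≁ d → u ≁ a′ → e ~ u
    push d-x e∈D (inj₁ refl)    x~u u~b u≁d u≁a′ = x~u
    push d-x e∈D dom@(inj₂ e~x) x~u u~b u≁d u≁a′ = ~-stable λ e≁u →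
      P₆ e~x x~u u~b (~-sym d~b) d~a′
        e≁u (e≁nbr d~b) e≁d (e≁nbr d~a′)
        (≁-sym (far⇒no-common d-x d~b)) (≁-sym (far⇒≁ d-x)) (≁-sym (far⇒no-common d-x d~a′))
        u≁d u≁a′ b≁a′
      where open Undominated (proj₁ d-x) (far⇒≁ d-x) e∈D dom

    module _ {h} (v~h : v ~ h) (h~w : h ~ w) where

      h≁d : h ≁ d
      h≁d = v-nbr≁d v~h

      z≁h : z ≁ h
      z≁h z~h = z-nbr≁w z~h h~w

      -- If `h ≁ b`, the path `w h v m b d` forces `h ~ m`, and then `w h m b d a′` is chordless.
      h~b : h ≁ a′ → h ~ b
      h~b h≁a′ = ~-stable λ h≁b →
        let h~m = ~-stable λ h≁m →
              P₆ (~-sym h~w) (~-sym v~h) v~m m~b (~-sym d~b)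
                w≁v (≁-sym m≁w) (w≁nbr d~b) w≁d h≁m h≁b h≁d (v≁nbr d~b) v≁d m≁d
        in P₆ (~-sym h~w) h~m m~b (~-sym d~b) d~a′
             (≁-sym m≁w) (w≁nbr d~b) w≁d (w≁nbr d~a′) h≁b h≁d h≁a′ m≁d m≁a′ b≁a′

      -- If `e` is neither `v` nor `w`, then `push` gives `e ~ m`, and `w e m b d a′` is chordless.
      common-dominator-absurd : e ∈ D → Dominates G e v → Dominates G e w → ⊥
      common-dominator-absurd e∈D (inj₁ refl) (inj₁ refl) = adj-irrefl (G ²) refl v≈w
      common-dominator-absurd e∈D (inj₁ refl) (inj₂ v~w)  = w≁v (~-sym v~w)
      common-dominator-absurd e∈D (inj₂ w~v)  (inj₁ refl) = w≁v w~v
      common-dominator-absurd e∈D dom@(inj₂ e~v) (inj₂ e~w) =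
        P₆ (~-sym e~w) (push d-v e∈D dom v~m m~b m≁d m≁a′) m~b (~-sym d~b) d~a′
          (≁-sym m≁w) (w≁nbr d~b) w≁d (w≁nbr d~a′) (e≁nbr d~b) e≁d (e≁nbr d~a′)
          m≁d m≁a′ b≁a′
        where open Undominated (proj₁ d-v) (far⇒≁ d-v) e∈D dom

      -- Otherwise v and w would have the same dominator.
      h~a′ : h ~ a′
      h~a′ = ~-stable λ h≁a′ →
        let e , e∈D , e-v = dominator v
            f , f∈D , f-w = dominator w
            e~h = push d-v e∈D e-v v~h (h~b h≁a′) h≁d h≁a′
            f~h = push d-w f∈D f-w (~-sym h~w) (h~b h≁a′) h≁d h≁a′
        in common-dominator-absurd e∈D e-v
             (subst (λ x → Dominates G x w) (dominator-unique f∈D e∈D (inj₂ f~h) (inj₂ e~h)) f-w)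

      module _ {p} (a~p : a ~ p) (p~w : p ~ w) where

        h≁a : h ≁ a
        h≁a = v-nbr≁a v~h

        p≁v : p ≁ v
        p≁v p~v = far⇒no-common v-a (~-sym p~v) (~-sym a~p)

        p≁z : p ≁ z
        p≁z p~z = z-nbr≁w (~-sym p~z) p~w

        d≁p : d ≁ p
        d≁p = ≁-sym (w-nbr≁d (~-sym p~w))

        p~h : p ~ h
        p~h = ~-stable λ p≁h →
          P₆ d~a a~p p~w (~-sym h~w) (~-sym v~h)
            d≁p (≁-sym w≁d) (≁-sym h≁d) (≁-sym v≁d)
            (≁-sym (w≁nbr d~a)) (≁-sym h≁a) (≁-sym (v≁nbr d~a)) p≁h p≁v w≁v

        -- `d a p h v` is now an induced path, so no neighbour of `v` can miss the other four
        -- vertices. This excludes `z` here and is applied to the dominator of `v` in `absurd`.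
        v≁z : v ≁ z
        v≁z v~z = P₆ d~a a~p p~h (~-sym v~h) v~z
          d≁p (≁-sym h≁d) (≁-sym v≁d) d≁z
          (≁-sym h≁a) (≁-sym (v≁nbr d~a)) (≁-sym (v-nbr≁a v~z)) p≁v p≁z (≁-sym z≁h)

        module _ {c} (v~c : v ~ c) (c~z : c ~ z) where

          c≁a′ : c ≁ a′
          c≁a′ = z-nbr≁a′ (~-sym c~z)

          d≁c : d ≁ c
          d≁c = ≁-sym (v-nbr≁d v~c)

          h~c : h ~ c
          h~c = ~-stable λ h≁c →
            P₆ d~a′ (~-sym h~a′) (~-sym v~h) v~c c~z
              (≁-sym h≁d) (≁-sym v≁d) d≁c d≁z
              (≁-sym (v≁nbr d~a′)) (≁-sym c≁a′) (≁-sym z≁a′) h≁c (≁-sym z≁h) v≁z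

          -- The chordless path is `d a p h v e`, with `e` the dominator of `v`. The dominator `f`
          -- of `z` differs from `e` and turns out to dominate both `p` and `h`, so `e` is adjacent
          -- to neither.
          absurd : ⊥
          absurd with dominator v | outer-dominator Nz
          ... | e , e∈D , e-v | f , f∈D , f~z , f≁d , f≁N =
            P₆ d~a a~p p~h (~-sym v~h) (~-sym e~v)
              d≁p (≁-sym h≁d) (≁-sym v≁d) (≁-sym E.e≁d)
              (≁-sym h≁a) (≁-sym (v≁nbr d~a)) (≁-sym (E.e≁nbr d~a)) p≁v
              (λ p~e → e≢f (dominator-unique e∈D f∈D (inj₂ (~-sym p~e)) (inj₂ f~p)))
              (≁-sym e≁h)
            where
            module E = Undominated (proj₁ d-v) (far⇒≁ d-v) e∈D e-v

            -- Otherwise `f` is a common neighbour of `v` and `z`, hence adjacent to `b`, which only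
            -- `d` dominates.
            f≁v : f ≁ v
            f≁v f~v = f≁N d~b (link-to-b v≁z (~-sym f~v) f~z)

            e≢f : e ≢ f
            e≢f refl = [ (λ e≡v → v≁z (subst (_~ z) e≡v f~z)) , f≁v ] e-v

            e~c : e ~ c
            e~c = push d-v e∈D e-v v~c (link-to-b v≁z v~c c~z) (v-nbr≁d v~c) c≁a′

            f≁c : f ≁ c
            f≁c f~c = e≢f (dominator-unique e∈D f∈D (inj₂ e~c) (inj₂ f~c))

            -- Since `e` dominates `c`, `f` does not; so without this edge `d a′ h c z f` is
            -- chordless.
            f~h : f ~ h
            f~h = ~-stable λ f≁h →
              P₆ d~a′ (~-sym h~a′) h~c c~z (~-sym f~z)
                (≁-sym h≁d) d≁c d≁z (≁-sym f≁d)
                (≁-sym c≁a′) (≁-sym z≁a′) (≁-sym (f≁N d~a′)) (≁-sym z≁h) (≁-sym f≁h) (≁-sym f≁c)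

            a≁z : a ≁ z
            a≁z a~z = P₆ d~a a~z (~-sym f~z) f~h (~-sym v~h)
              d≁z (≁-sym f≁d) (≁-sym h≁d) (≁-sym v≁d)
              (≁-sym (f≁N d~a)) (≁-sym h≁a) (≁-sym (v≁nbr d~a)) z≁h (≁-sym v≁z) f≁v

            -- Otherwise `d a p h f z` is chordless; `a≁z` excludes its one doubtful chord.
            f~p : f ~ p
            f~p = ~-stable λ f≁p →
              P₆ d~a a~p p~h (~-sym f~h) f~z
                d≁p (≁-sym h≁d) (≁-sym f≁d) d≁z
                (≁-sym h≁a) (≁-sym (f≁N d~a)) a≁z (≁-sym f≁p) p≁z (≁-sym z≁h)

            e≁h : e ≁ h
            e≁h e~h = e≢f (dominator-unique e∈D f∈D (inj₂ e~h) (inj₂ f~h))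

            e~v : e ~ v
            e~v = [ (λ e≡v → contradiction (subst (_~ h) (sym e≡v) v~h) e≁h) , id ] e-v

    ends-absurd : ⊥
    ends-absurd with near-cases v≈w | near-cases a≈w
    ... | inj₁ v~w | _ = w≁v (~-sym v~w)
    ... | inj₂ _   | inj₁ a~w = w≁nbr d~a (~-sym a~w)
    ... | inj₂ (_ , v~h , h~w) | inj₂ (_ , a~p , p~w) with near-cases v≈z
    ...   | inj₁ v~z = v≁z v~h h~w a~p p~w v~z
    ...   | inj₂ (_ , v~c , c~z) = absurd v~h h~w a~p p~w v~c c~z

  -- Alternation along the antihole.

  -- Here k is `2 + j`, so there are `5 + j * 2` vertices and the offsets of near pairs run from 2
  -- to 2k - 1. Indexing by `ℕ` keeps modular arithmetic out; `closed` makes the last vertex a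
  -- cyclic neighbour of `w 0`.
  no-odd-antihole-sequence : ∀ j (w : ℕ → Fin n) →
    (∀ m → Far (w m) (w (suc m))) →
    (∀ m {e} → 2 ≤ e → 2 + e ≤ 5 + j * 2 → Near (w m) (w (m + e))) →
    w (5 + j * 2) ≡ w 0 → w 0 ≢ d
  no-odd-antihole-sequence j w far near closed refl =
    [ first-absurd , second-absurd ] (first-or-second 2 ≤-refl (m≤m+n 2 _))
    where
    last-far : Far (w 0) (w (4 + j * 2))
    last-far = far-sym (subst (Far (w (4 + j * 2))) closed (far _))

    first-or-second : ∀ m → 2 ≤ m → m ≤ 3 + j * 2 → d ~ w m ⊎ SecondNeighbour (w m)
    first-or-second m 2≤m m≤3+2j with adj? G d (w m) | near 0 2≤m (s≤s (s≤s m≤3+2j))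
    ... | yes d~w | _ = inj₁ d~w
    ... | no  d≁w | d≈w with near-cases d≈w
    ...   | inj₁ d~w             = inj₁ d~w
    ...   | inj₂ (_ , d~b , b~w) = inj₂ (via (λ d≡w → adj-irrefl (G ²) d≡w d≈w) d≁w d~b b~w)

    first⇒second : ∀ m → 2 ≤ m → m < 3 + j * 2 → d ~ w m → SecondNeighbour (w (suc m))
    first⇒second m 2≤m m<3+2j d~w =
      [ (λ d~w′ → contradiction d~w′ (far⇒no-common (far m) (~-sym d~w))) , id ]
        (first-or-second (suc m) (m≤n⇒m≤1+n 2≤m) m<3+2j)

    second⇒first : ∀ m → 2 ≤ m → m < 3 + j * 2 → SecondNeighbour (w m) → d ~ w (suc m)
    second⇒first m 2≤m m<3+2j Nw =
      [ id , (λ Nw′ → contradiction (far m) (second-neighbours-not-far Nw Nw′)) ]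
        (first-or-second (suc m) (m≤n⇒m≤1+n 2≤m) m<3+2j)

    -- Two alternation steps restore the type, so the type of v₂ is carried to v₂ₖ₋₂, reached at
    -- `t = j`.
    evens : (P : Fin n → Set) →
      (∀ m → 2 ≤ m → 2 + m ≤ 3 + j * 2 → P (w m) → P (w (2 + m))) →
      P (w 2) → ∀ t → t ≤ j → P (w (2 + t * 2))
    evens P step p zero    _   = p
    evens P step p (suc t) t<j =
      step (2 + t * 2) (m≤m+n 2 _) (m≤n⇒m≤1+n (s≤s (s≤s (*-monoˡ-≤ 2 t<j))))
        (evens P step p t (<⇒≤ t<j))

    first-absurd : ¬ d ~ w 2
    first-absurd d~w₂ = Ends.ends-absurd d~w₂ d~a′
      (first⇒second (2 + j * 2) (m≤m+n 2 _) ≤-refl d~a′)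
      (far 0) last-far (far 1) (far _) (far _)
      (near 1 (m≤m+n 2 _) (n≤1+n _)) (near 1 (m≤m+n 2 _) ≤-refl) (near 2 (m≤m+n 2 _) (n≤1+n _))
      where
      d~a′ : d ~ w (2 + j * 2)
      d~a′ = evens (d ~_)
        (λ m 2≤m m<2+2j → second⇒first (suc m) (m≤n⇒m≤1+n 2≤m) m<2+2j ∘ first⇒second m 2≤m (<⇒≤ m<2+2j))
        d~w₂ j ≤-refl

    -- The mirror image: in `Ends`, `z` is `w 2`, `a′` is `w 3`, `a` is `w (3 + j * 2)`, `v` is
    -- `w (4 + j * 2)` and `w` is `w 1`.
    second-absurd : ¬ SecondNeighbour (w 2)
    second-absurd Nw₂ = Ends.ends-absurd
      (second⇒first (2 + j * 2) (m≤m+n 2 _) ≤-refl N-last)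
      (second⇒first 2 ≤-refl (m≤m+n 3 _) Nw₂) Nw₂
      last-far (far 0) (far-sym (far _)) (far-sym (far 2)) (far-sym (far 1))
      (near-sym (near 2 (m≤m+n 2 _) (n≤1+n _))) (near-sym (near 1 (m≤m+n 2 _) ≤-refl))
      (near-sym (near 1 (m≤m+n 2 _) (n≤1+n _)))
      where
      near-sym : Near x y → Near y x
      near-sym = adj-sym (G ²)

      N-last : SecondNeighbour (w (2 + j * 2))
      N-last = evens SecondNeighbour
        (λ m 2≤m m<2+2j → first⇒second (suc m) (m≤n⇒m≤1+n 2≤m) m<2+2j ∘ second⇒first m 2≤m (<⇒≤ m<2+2j))
        Nw₂ j ≤-refl

-- Arithmetic modulo `N`.

module _ {N} .{{_ : NonZero N}} where

  +-congʳ-% : ∀ c x y → x % N ≡ y % N → (c + x) % N ≡ (c + y) % N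
  +-congʳ-% c x y eq = begin
    (c + x) % N         ≡⟨ %-distribˡ-+ c x N ⟩
    (c % N + x % N) % N ≡⟨ cong (λ r → (c % N + r) % N) eq ⟩
    (c % N + y % N) % N ≡⟨ %-distribˡ-+ c y N ⟨
    (c + y) % N         ∎
    where open ≡-Reasoning

  -- Adding `pred N` to a successor completes a full turn of `N`.
  suc-cancel-% : ∀ x y → suc x % N ≡ suc y % N → x % N ≡ y % N
  suc-cancel-% x y eq = begin
    x % N                  ≡⟨ shift x ⟨
    (pred N + suc x) % N   ≡⟨ +-congʳ-% (pred N) (suc x) (suc y) eq ⟩
    (pred N + suc y) % N   ≡⟨ shift y ⟩
    y % N                  ∎
    where
    open ≡-Reasoning
    shift : ∀ x → (pred N + suc x) % N ≡ x % N
    shift x = begin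
      (pred N + suc x) % N   ≡⟨ cong (_% N) (+-suc (pred N) x) ⟩
      suc (pred N + x) % N   ≡⟨ cong (λ M → (M + x) % N) (suc-pred N) ⟩
      (N + x) % N            ≡⟨ cong (_% N) (+-comm N x) ⟩
      (x + N) % N            ≡⟨ [m+n]%n≡m%n x N ⟩
      x % N                  ∎

  +-cancelʳ-% : ∀ {a b} x → a < N → b < N → (a + x) % N ≡ (b + x) % N → a ≡ b
  +-cancelʳ-% {a} {b} x a<N b<N eq =
    trans (sym (m<n⇒m%n≡m a<N)) (trans (go x eq) (m<n⇒m%n≡m b<N))
    where
    go : ∀ x → (a + x) % N ≡ (b + x) % N → a % N ≡ b % N
    go zero    eq = subst₂ (λ a b → a % N ≡ b % N) (+-identityʳ a) (+-identityʳ b) eq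
    go (suc x) eq = go x (suc-cancel-% (a + x) (b + x)
      (subst₂ (λ a b → a % N ≡ b % N) (+-suc a x) (+-suc b x) eq))

  toℕ-mod : ∀ x → toℕ (x mod N) ≡ x % N
  toℕ-mod x = toℕ-fromℕ< (m%n<n x N)

  -- The relation from which `cycle N` is built, so that adjacency there unfolds to it.
  CyclicSuc : Fin N → Fin N → Set
  CyclicSuc i j = toℕ j ≡ suc (toℕ i) ⊎ (suc (toℕ i) ≡ N × toℕ j ≡ 0)

  mod-suc : ∀ x → CyclicSuc (x mod N) (suc x mod N)
  mod-suc x with m≤n⇒m<n∨m≡n (m%n<n x N)
  ... | inj₁ 1+x<N = inj₁ (begin
    toℕ (suc x mod N)  ≡⟨ toℕ-mod (suc x) ⟩
    suc x % N          ≡⟨ +-congʳ-% 1 (x % N) x (m%n%n≡m%n x N) ⟨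
    suc (x % N) % N    ≡⟨ m<n⇒m%n≡m 1+x<N ⟩
    suc (x % N)        ≡⟨ cong suc (toℕ-mod x) ⟨
    suc (toℕ (x mod N)) ∎)
    where open ≡-Reasoning
  ... | inj₂ 1+x≡N = inj₂ (trans (cong suc (toℕ-mod x)) 1+x≡N , (begin
    toℕ (suc x mod N)  ≡⟨ toℕ-mod (suc x) ⟩
    suc x % N          ≡⟨ +-congʳ-% 1 (x % N) x (m%n%n≡m%n x N) ⟨
    suc (x % N) % N    ≡⟨ cong (_% N) 1+x≡N ⟩
    N % N              ≡⟨ n%n≡0 N ⟩
    0                  ∎))
    where open ≡-Reasoning

  CyclicSuc⇒% : ∀ {i j} → CyclicSuc i j → toℕ j % N ≡ suc (toℕ i) % N
  CyclicSuc⇒% (inj₁ j≡1+i)         = cong (_% N) j≡1+i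
  CyclicSuc⇒% (inj₂ (1+i≡N , j≡0)) =
    trans (cong (_% N) j≡0) (trans (sym ([m+n]%n≡m%n 0 N)) (cong (_% N) (sym 1+i≡N)))

  CyclicSuc-mod⇒% : ∀ x y → CyclicSuc (x mod N) (y mod N) → y % N ≡ suc x % N
  CyclicSuc-mod⇒% x y r = begin
    y % N                   ≡⟨ m%n%n≡m%n y N ⟨
    y % N % N               ≡⟨ cong (_% N) (toℕ-mod y) ⟨
    toℕ (y mod N) % N       ≡⟨ CyclicSuc⇒% r ⟩
    suc (toℕ (x mod N)) % N ≡⟨ cong (λ t → suc t % N) (toℕ-mod x) ⟩
    suc (x % N) % N         ≡⟨ +-congʳ-% 1 (x % N) x (m%n%n≡m%n x N) ⟩
    suc x % N               ∎
    where open ≡-Reasoning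

  mod-injective : ∀ x y → x mod N ≡ y mod N → x % N ≡ y % N
  mod-injective x y eq = trans (sym (toℕ-mod x)) (trans (cong toℕ eq) (toℕ-mod y))

  toℕ-mod-id : ∀ (i : Fin N) → toℕ i mod N ≡ i
  toℕ-mod-id i = toℕ-injective (trans (toℕ-mod (toℕ i)) (m<n⇒m%n≡m (toℕ<n i)))

-- The antihole read as a cyclic sequence.

module CyclicSequence {n N} .{{_ : NonZero N}} (2≤N : 2 ≤ N) (H : Graph n)
  (copy : InducedCopy (complement (cycle N)) H) (i : Fin N) where

  open InducedCopy copy

  -- The shift by `i` lets the sequence start at any chosen real vertex.
  at : ℕ → Fin n
  at m = vertex ((m + toℕ i) mod N)

  at-0 : at 0 ≡ vertex i
  at-0 = cong vertex (toℕ-mod-id i)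

  at-N : at N ≡ at 0
  at-N = cong vertex (toℕ-injective (begin
    toℕ ((N + toℕ i) mod N) ≡⟨ toℕ-mod (N + toℕ i) ⟩
    (N + toℕ i) % N         ≡⟨ cong (_% N) (+-comm N (toℕ i)) ⟩
    (toℕ i + N) % N         ≡⟨ [m+n]%n≡m%n (toℕ i) N ⟩
    toℕ i % N               ≡⟨ toℕ-mod (toℕ i) ⟨
    toℕ (toℕ i mod N)       ∎))
    where open ≡-Reasoning

  at-suc-nonadjacent : ∀ m → Adj (complement H) (at m) (at (suc m))
  at-suc-nonadjacent m = distinct ∘ injective , λ adj →
    proj₂ (from (adjacency _ _) adj) (distinct , inj₁ (mod-suc (m + toℕ i)))
    where
    distinct : (m + toℕ i) mod N ≢ suc (m + toℕ i) mod N
    distinct eq = 0≢1+n (+-cancelʳ-% (m + toℕ i) (<-trans (n<1+n 0) 2≤N) 2≤N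
      (mod-injective (m + toℕ i) (suc (m + toℕ i)) eq))

  at-+-adjacent : ∀ m {e} → 2 ≤ e → 2 + e ≤ N → Adj H (at m) (at (m + e))
  at-+-adjacent m {e} 2≤e 2+e≤N = to (adjacency _ _) (distinct , nonconsecutive)
    where
    x = m + toℕ i

    m+e+i≡e+x : m + e + toℕ i ≡ e + x
    m+e+i≡e+x = trans (cong (_+ toℕ i) (+-comm m e)) (+-assoc e m (toℕ i))

    distinct : x mod N ≢ (m + e + toℕ i) mod N
    distinct rewrite m+e+i≡e+x = λ eq → <⇒≢ (<-trans (n<1+n 0) 2≤e)
      (+-cancelʳ-% x (<-trans (n<1+n 0) 2≤N) (<-trans (n<1+n e) 2+e≤N)
        (mod-injective x (e + x) eq))

    nonconsecutive : ¬ Adj (cycle N) (x mod N) ((m + e + toℕ i) mod N)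
    nonconsecutive rewrite m+e+i≡e+x = λ where
      -- Cancelling `x` leaves `e ≡ 1`.
      (_ , inj₁ r) → <⇒≢ 2≤e (sym (+-cancelʳ-% x (<-trans (n<1+n e) 2+e≤N) 2≤N
        (CyclicSuc-mod⇒% x (e + x) r)))
      -- Wrapping round would need `suc e` to vanish modulo `N`, but `suc e < N`.
      (_ , inj₂ r) → 0≢1+n (+-cancelʳ-% x (<-trans (n<1+n 0) 2≤N) 2+e≤N
        (CyclicSuc-mod⇒% (e + x) x r))

∈vertexSet⁻ : ∀ {m n} {H : Graph m} {G : Graph n} (copy : InducedCopy H G) {x} →
  x ∈ InducedCopy.vertexSet copy → ∃ λ i → InducedCopy.vertex copy i ≡ x
∈vertexSet⁻ copy {x} x∈ =
  witness (any? λ i → vertex i ≟ᶠ x) (trans (sym (lookup∘tabulate _ x)) ([]=⇒lookup x∈))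
  where
  open InducedCopy copy
  -- With the decision as a variable, its negative case is refuted by the type of the equation
  -- alone.
  witness : (p? : Dec (∃ λ i → vertex i ≡ x)) → does p? ≡ true → ∃ λ i → vertex i ≡ x
  witness (yes p) _ = p

theorem3 : ∀ {n : ℕ} (G : Graph n) → G IsFreeOf path 6 →
    (D : Subset n) → IsEfficientDominatingSet G D →
    (C : OddAntihole (G ²)) → ∣ D ∩ realVertices C ∣ ≡ 0
theorem3 {n} G P₆-free D efficient record { k = suc (suc j) ; 2≤k = s≤s (s≤s z≤n) ; copy = copy } =
  trans (cong ∣_∣ (Empty-unique disjoint)) (∣⊥∣≡0 n)
  where
  2k+1≡5+2j : 2 * suc (suc j) + 1 ≡ 5 + j * 2
  2k+1≡5+2j = trans (+-comm (2 * (2 + j)) 1) (cong suc (*-comm 2 (2 + j)))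

  disjoint : Empty (D ∩ InducedCopy.vertexSet copy)
  disjoint (d , d∈) with x∈p∩q⁻ D _ d∈
  ... | d∈D , d∈C with ∈vertexSet⁻ copy d∈C
  -- Starting the sequence at `i` makes `at-0` the very equation to be refuted.
  ...   | i , refl = no-odd-antihole-sequence G P₆-free D efficient d∈D j at
    at-suc-nonadjacent
    (λ m {e} 2≤e 2+e≤N → at-+-adjacent m 2≤e (subst (2 + e ≤_) (sym 2k+1≡5+2j) 2+e≤N))
    (trans (cong at (sym 2k+1≡5+2j)) at-N) at-0
    where
    open EfficientDomination
    open CyclicSequence (s≤s (s≤s z≤n)) (G ²) copy i
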